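{- Let $C_n$ denote the cycle on $n$ vertices. For every $n \ge 4$, $$\iota_{\rm g}(C_n)=\begin{cases}2\left\lceil \frac{n}{5}\right\rceil, & \text{if } n\equiv 0 \pmod 5,\\[2pt] 2\left\lceil \frac{n}{5}\right\rceil-1, & \text{otherwise},\end{cases}$$ and $$\iota_{\rm g}'(C_n)=\begin{cases}2\left\lfloor \frac{n}{5}\right\rfloor+1, & \text{if } n\equiv 4 \pmod 5,\\[2pt] 2\left\lfloor \frac{n}{5}\right\rfloor, & \text{otherwise}.\end{cases}$$
   Context: For a graph $G$ and $X\subseteq V(G)$, $N_G[X]$ denotes the set of vertices in $X$ or adjacent to a vertex of $X$. The isolation game on a finite graph $G$ is played by two players, Dominator and Staller, who alternately select vertices of $G$. If $X$ is the set of vertices selected so far, a vertex $x$ may be selected (is playable) only if $x$ dominates (i.e., equals or is adjacent to) some vertex belonging to a component of $G - N_G[X]$ with at least two vertices. The game ends when no playable vertex exists. Dominator aims to minimize the total number of selected vertices, Staller aims to maximize it. The game isolation number $\iota_{\rm g}(G)$ is the number of vertices selected when Dominator makes the first move and both play optimally; $\iota_{\rm g}'(G)$ is the same quantity when Staller makes the first move. -}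

module Defs where

open import Data.Bool using (Bool; true; false; _∧_; _∨_; not; if_then_else_)
open import Data.Nat using (ℕ; zero; suc; _+_; _∸_; _⊓_; _⊔_; _≡ᵇ_; _≤ᵇ_)
open import Data.Nat.DivMod using (_/_; _%_)
open import Data.Fin using (Fin; toℕ; _≟_)
open import Data.List using (List; []; _∷_; allFin; filter; map; foldr; length)
open import Data.Bool.ListAction using (any)
open import Relation.Nullary.Decidable using (⌊_⌋)
open import Relation.Unary using (Decidable)
open import Relation.Binary.PropositionalEquality using (_≡_)

Adj : ℕ → Set
Adj n = Fin n → Fin n → Bool

VSet : ℕ → Set
VSet n = Fin n → Bool

anyV : ∀ {n} → VSet n → Bool
anyV {n} P = any P (allFin n)

card : ∀ {n} → VSet n → ℕ
card {n} P = length (filter (λ v → P v Data.Bool.≟ true) (allFin n))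

emptyV : ∀ {n} → VSet n
emptyV _ = false

insertV : ∀ {n} → VSet n → Fin n → VSet n
insertV X x v = X v ∨ ⌊ v ≟ x ⌋

module Game {n : ℕ} (adj : Adj n) where

  closedNbhd : VSet n → VSet n
  closedNbhd X v = X v ∨ anyV (λ u → X u ∧ adj u v)

  residual : VSet n → VSet n
  residual X v = not (closedNbhd X v)

  reach : VSet n → ℕ → Fin n → VSet n
  reach X zero    y v = residual X y ∧ ⌊ v ≟ y ⌋
  reach X (suc k) y v =
    reach X k y v ∨ (residual X v ∧ anyV (λ u → reach X k y u ∧ adj u v))

  -- the connected component of G - N[X] containing y (empty if y ∉ G - N[X]);
  -- walks of length < n suffice
  component : VSet n → Fin n → VSet n
  component X y = reach X n y

  inBigComponent : VSet n → Fin n → Bool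
  inBigComponent X y = residual X y ∧ (2 ≤ᵇ card (component X y))

  playable : VSet n → Fin n → Bool
  playable X x = anyV (λ y → inBigComponent X y ∧ (⌊ x ≟ y ⌋ ∨ adj x y))

  playableList : VSet n → List (Fin n)
  playableList X = filter (λ x → playable X x Data.Bool.≟ true) (allFin n)

  data Player : Set where
    Dominator Staller : Player

  other : Player → Player
  other Dominator = Staller
  other Staller   = Dominator

  -- Minimax value (number of moves still to be played under optimal play)
  -- from position X with player p to move.  The fuel bounds the number of
  -- remaining moves; every move selects a new vertex (a vertex of X is never
  -- playable), so fuel n is enough for the whole game.
  value : ℕ → Player → VSet n → ℕ
  value zero    p X = 0
  value (suc k) p X with playableList X
  ... | []     = 0
  ... | x ∷ xs = suc (opt p (value k (other p) (insertV X x))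
                            (map (λ y → value k (other p) (insertV X y)) xs))
    where
    opt : Player → ℕ → List ℕ → ℕ
    opt Dominator a as = foldr _⊓_ a as
    opt Staller   a as = foldr _⊔_ a as

  ιg : ℕ
  ιg = value n Dominator emptyV

  ιg′ : ℕ
  ιg′ = value n Staller emptyV

cycleAdj : (n : ℕ) → Adj n
cycleAdj zero    i j = false
cycleAdj (suc m) i j =
  ((toℕ j ≡ᵇ (toℕ i + 1) % suc m) ∨ (toℕ i ≡ᵇ (toℕ j + 1) % suc m))
  ∧ not ⌊ i ≟ j ⌋

ιg-C : ℕ → ℕ
ιg-C n = Game.ιg (cycleAdj n)

ιg′-C : ℕ → ℕ
ιg′-C n = Game.ιg′ (cycleAdj n)

⌈_/5⌉ : ℕ → ℕ
⌈ n /5⌉ = (n + 4) / 5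

⌊_/5⌋ : ℕ → ℕ
⌊ n /5⌋ = n / 5

{-# OPTIONS --safe #-}
-- After the first move the undominated vertices form separated paths, and only
-- paths with k ≥ 2 vertices matter.  Two potentials bracket the game: the number
-- k - 1 of undominated edges and the weight k + 2, each summed over these paths.
-- Every move removes at most 4 edges, and Staller can remove just 1 by playing the
-- dominated vertex next to a path.  Every move removes at least 1 from the weight,
-- and Dominator can remove 4 by isolating the first vertex of a path and dominating
-- the next three.  Hence two consecutive moves cost 5 in both estimates, and the two
-- bounds agree once the first move, from the full cycle, is treated separately.
module Submission where

open import Defs
open import Data.Nat using (ℕ; _≤_; _*_; _+_; _∸_)
open import Data.Nat.DivMod using (_%_)
open import Data.Product using (_×_)
open import Relation.Nullary using (¬_)
open import Relation.Binary.PropositionalEquality using (_≡_)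

open import Data.Bool using (Bool; true; false; _∧_; _∨_; not; T)
open import Data.Bool.Properties using (T-≡; T-∧; T-∨; T-not-≡; T?)
import Data.Bool as Bool
open import Data.Empty using (⊥-elim)
open import Data.Fin using (Fin; toℕ; _≟_)
open import Data.Fin.Properties using (toℕ-injective; toℕ-fromℕ<; toℕ<n)
open import Data.List using (List; []; _∷_; allFin; filter; length)
open import Data.List.Membership.Propositional using (_∈_; lose; find)
open import Data.List.Membership.Propositional.Properties
  using (∈-allFin; ∈-filter⁺; ∈-filter⁻)
open import Data.List.Properties using (foldr-preservesᵇ; foldr-preservesᵒ)
open import Data.List.Relation.Unary.All as All using ([]; _∷_)
import Data.List.Relation.Unary.All.Properties as All
open import Data.List.Relation.Unary.AllPairs using ([]; _∷_)
open import Data.List.Relation.Unary.Any using (here; there)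
import Data.List.Relation.Unary.Any.Properties as Any
open import Data.List.Relation.Unary.Unique.Propositional using (Unique)
import Data.List.Relation.Unary.Unique.Propositional.Properties as Unique
open import Data.Nat
  using (zero; suc; _<_; z≤n; s≤s; s≤s⁻¹; _≡ᵇ_; _/_; _≤?_)
open import Data.Nat.DivMod
  using (_mod_; m%n<n; m<n⇒m%n≡m; m≡m%n+[m/n]*n; m%n%n≡m%n; %-distribˡ-+;
         [m+n]%n≡m%n; [m+kn]%n≡m%n; %-pred-≡0; +-distrib-/-∣ˡ)
open import Data.Nat.Divisibility using (divides)
open import Data.Nat.Properties hiding (_≟_; _≤?_)
open import Data.Product using (∃; ∃₂; _,_; proj₁; proj₂)
open import Data.Sum using (_⊎_; inj₁; inj₂; [_,_]′; swap)
import Data.Sum as Sum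
open import Data.Unit using (tt)
open import Data.Vec using (Vec; []; _∷_)
open import Function using (_∘_; id; case_of_)
open import Function.Bundles using (module Equivalence)
open import Relation.Nullary using (Dec; yes; no; contradiction)
open import Relation.Nullary.Decidable
  using (⌊_⌋; toWitness; fromWitness; map′; ¬?; _×-dec_; _⊎-dec_; _→-dec_)
open import Relation.Binary.PropositionalEquality
  using (_≢_; refl; sym; trans; cong; cong₂; subst; module ≡-Reasoning)

open Equivalence using (to; from)

-- Witnesses for Boolean search and cardinality

anyV⁺ : ∀ {n} (P : VSet n) v → T (P v) → T (anyV P)
anyV⁺ P v p = Any.any⁺ P (lose (∈-allFin v) p)

anyV⁻ : ∀ {n} (P : VSet n) → T (anyV P) → ∃ λ v → T (P v)
anyV⁻ {n} P p with v , _ , q ← find (Any.any⁻ P (allFin n) p) = v , q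

module _ {n : ℕ} (P : VSet n) where

  private
    members : List (Fin n)
    members = filter (λ v → P v Bool.≟ true) (allFin n)

    ∈-members⁺ : ∀ {v} → T (P v) → v ∈ members
    ∈-members⁺ {v} p = ∈-filter⁺ (λ v → P v Bool.≟ true) (∈-allFin v) (to T-≡ p)

    ∈-members⁻ : ∀ {v} → v ∈ members → T (P v)
    ∈-members⁻ v∈ =
      from T-≡ (proj₂ (∈-filter⁻ (λ v → P v Bool.≟ true) {xs = allFin n} v∈))

  card≥2⁺ : ∀ {u v} → T (P u) → T (P v) → u ≢ v → 2 ≤ card P
  card≥2⁺ pu pv u≢v = go members (∈-members⁺ pu) (∈-members⁺ pv) u≢v
    where
    go : ∀ xs {u v : Fin n} → u ∈ xs → v ∈ xs → u ≢ v → 2 ≤ length xs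
    go (_ ∷ [])    (here refl) (here refl) u≢v = contradiction refl u≢v
    go (_ ∷ _ ∷ _) _           _           _   = s≤s (s≤s z≤n)

  -- The list of members has no duplicates, so one of its first two entries differs from `u`.
  card≥2⁻ : ∀ u → 2 ≤ card P → ∃ λ v → T (P v) × v ≢ u
  card≥2⁻ u 2≤ =
    go members (Unique.filter⁺ (λ v → P v Bool.≟ true) (Unique.allFin⁺ n)) ∈-members⁻ 2≤
    where
    go : ∀ xs → Unique xs → (∀ {v} → v ∈ xs → T (P v)) → 2 ≤ length xs →
         ∃ λ v → T (P v) × v ≢ u
    go (_ ∷ []) _ _ (s≤s ())
    go (v ∷ w ∷ _) ((v≢w ∷ _) ∷ _) sound _ with v ≟ u
    ... | no v≢u   = v , sound (here refl) , v≢u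
    ... | yes refl = w , sound (there (here refl)) , v≢w ∘ sym

-- The isolation game on an arbitrary graph

module GameProperties {n : ℕ} (adj : Adj n) where

  open Game adj

  -- Records, so that with-abstraction does not normalise the Boolean tests inside.
  record ResidualEdge (X : VSet n) (y u : Fin n) : Set where
    constructor residualEdge
    field
      source   : T (residual X y)
      target   : T (residual X u)
      adjacent : T (adj y u)

  record Playable (X : VSet n) (x : Fin n) : Set where
    constructor legal
    field
      holds : T (playable X x)

  open Playable

  module _ (X : VSet n) where

    reach-self : ∀ k {y} → T (residual X y) → T (reach X k y y)
    reach-self zero    r = from T-∧ (r , fromWitness refl)
    reach-self (suc k) r = from T-∨ (inj₁ (reach-self k r))

    reach-neighbour : ∀ k {y u} → ResidualEdge X y u → T (reach X (suc k) y u)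
    reach-neighbour k {y} (residualEdge ry ru yu) =
      from T-∨ (inj₂ (from T-∧ (ru , anyV⁺ _ y (from T-∧ (reach-self k ry , yu)))))

    -- Trace the walk back from `v`: once the preceding vertex is `y` itself, that step is the
    -- required edge. Thus a component with two vertices gives `y` an undominated neighbour.
    reach-first-edge : ∀ k {y v} → T (residual X y) → T (reach X k y v) → v ≢ y →
                       ∃ (ResidualEdge X y)
    reach-first-edge zero {y} {v} ry p v≢y =
      contradiction (toWitness {a? = v ≟ y} (proj₂ (to (T-∧ {residual X y}) p))) v≢y
    reach-first-edge (suc k) {y} {v} ry p v≢y with to T-∨ p
    ... | inj₁ q = reach-first-edge k ry q v≢y
    ... | inj₂ q with rv , q′ ← to T-∧ q
                 with u , q″ ← anyV⁻ _ q′
                 with yu , uv ← to T-∧ q″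
                 with u ≟ y
    ...   | yes refl = v , residualEdge ry rv uv
    ...   | no u≢y   = reach-first-edge k ry yu u≢y

    playable⁻ : ∀ {x} → Playable X x →
                ∃₂ λ y u → ResidualEdge X y u × (x ≡ y ⊎ T (adj x y))
    playable⁻ (legal p) with y , q ← anyV⁻ _ p
                with big , near ← to T-∧ q
                with ry , two ← to T-∧ big
                with v , yv , v≢y ← card≥2⁻ (component X y) y (≤ᵇ⇒≤ 2 _ two)
                with u , e ← reach-first-edge n ry yv v≢y =
      y , u , e , [ inj₁ ∘ toWitness , inj₂ ]′ (to T-∨ near)

  playable⁺ : ∀ X {x y u} → ResidualEdge X y u → y ≢ u → T (adj x y) → Playable X x
  playable⁺ X {x} {y} {u} e@(residualEdge ry _ _) y≢u xy =
    legal (anyV⁺ _ y (from T-∧ (from T-∧ (ry , ≤⇒≤ᵇ big) , from T-∨ (inj₂ xy))))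
    where
    -- The vertex `y : Fin n` forces `n` to be positive, so `reach X n` allows at least one step.
    reach-u : ∀ {k} → Fin k → T (reach X k y u)
    reach-u {suc k} _ = reach-neighbour X k e

    big : 2 ≤ card (component X y)
    big = card≥2⁺ (component X y) (reach-self X n ry) (reach-u y) y≢u

  private
    ∈-playable⁺ : ∀ {X x} → Playable X x → x ∈ playableList X
    ∈-playable⁺ {X} {x} p =
      ∈-filter⁺ (λ x → playable X x Bool.≟ true) (∈-allFin x) (to T-≡ (holds p))

    ∈-playable⁻ : ∀ {X x} → x ∈ playableList X → Playable X x
    ∈-playable⁻ {X} x∈ =
      legal (from T-≡ (proj₂ (∈-filter⁻ (λ x → playable X x Bool.≟ true) {xs = allFin n} x∈)))

  -- Opaque, since value unfolds the game tree on a graph with n = suc k vertices.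
  opaque

    moves : ℕ → Player → VSet n → ℕ
    moves = value

    ιg-moves : ιg ≡ moves n Dominator emptyV
    ιg-moves = refl

    ιg′-moves : ιg′ ≡ moves n Staller emptyV
    ιg′-moves = refl

    moves-zero : ∀ p X → moves zero p X ≡ 0
    moves-zero p X = refl

    stuck⊎playable : ∀ X → (∀ k p → moves k p X ≡ 0) ⊎ ∃ λ x → Playable X x
    stuck⊎playable X with playableList X in eq
    ... | x ∷ _ = inj₂ (x , ∈-playable⁻ (subst (x ∈_) (sym eq) (here refl)))
    ... | []    = inj₁ stuck
      where
      stuck : ∀ k p → moves k p X ≡ 0
      stuck zero    p = refl
      stuck (suc k) p rewrite eq = refl

  module _ (k : ℕ) {X : VSet n} where

    opaque
      unfolding moves

      moves-Staller-≤ : ∀ {b} → (∀ x → Playable X x → moves k Dominator (insertV X x) ≤ b) →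
                        moves (suc k) Staller X ≤ suc b
      moves-Staller-≤ {b} bound with playableList X in eq
      ... | []     = z≤n
      ... | x ∷ xs = s≤s (foldr-preservesᵇ {P = _≤ b} ⊔-lub (option (here refl))
                           (All.map⁺ (All.tabulate (option ∘ there))))
        where
        option : ∀ {y} → y ∈ x ∷ xs → moves k Dominator (insertV X y) ≤ b
        option {y} y∈ = bound y (∈-playable⁻ (subst (y ∈_) (sym eq) y∈))

      moves-Staller-≥ : ∀ {x} → Playable X x →
                        suc (moves k Dominator (insertV X x)) ≤ moves (suc k) Staller X
      moves-Staller-≥ {x} p with playableList X | ∈-playable⁺ {X} p
      ... | y ∷ ys | x∈ =
        s≤s (foldr-preservesᵒ {P = moves k Dominator (insertV X x) ≤_}
              (λ a b → [ m≤n⇒m≤n⊔o b , m≤n⇒m≤o⊔n a ]′) _ _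
              (case x∈ of λ { (here refl) → inj₁ ≤-refl
                            ; (there x∈ys) → inj₂ (Any.map⁺ (lose x∈ys ≤-refl)) }))

      moves-Dominator-≤ : ∀ {x} → Playable X x →
                          moves (suc k) Dominator X ≤ suc (moves k Staller (insertV X x))
      moves-Dominator-≤ {x} p with playableList X | ∈-playable⁺ {X} p
      ... | y ∷ ys | x∈ =
        s≤s (foldr-preservesᵒ {P = _≤ moves k Staller (insertV X x)}
              (λ a b → [ m≤n⇒m⊓o≤n b , m≤n⇒o⊓m≤n a ]′) _ _
              (case x∈ of λ { (here refl) → inj₁ ≤-refl
                            ; (there x∈ys) → inj₂ (Any.map⁺ (lose x∈ys ≤-refl)) }))

      -- The playable `x` excludes a finished game, whose value `0` would violate the bound.
      moves-Dominator-≥ : ∀ {b x} → Playable X x →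
                          (∀ x → Playable X x → b ≤ moves k Staller (insertV X x)) →
                          suc b ≤ moves (suc k) Dominator X
      moves-Dominator-≥ {b} p bound with playableList X in eq | ∈-playable⁺ {X} p
      ... | x ∷ xs | _ = s≤s (foldr-preservesᵇ {P = b ≤_} ⊓-glb (option (here refl))
                               (All.map⁺ (All.tabulate (option ∘ there))))
        where
        option : ∀ {y} → y ∈ x ∷ xs → b ≤ moves k Staller (insertV X y)
        option {y} y∈ = bound y (∈-playable⁻ (subst (y ∈_) (sym eq) y∈))

-- Undominated vertices, path starts and the two potentials

bit : Bool → ℕ
bit b = Bool.if b then 1 else 0

none : Bool → Bool → Bool → Bool
none a b c = not (a ∨ b ∨ c)

-- For the indicator sequence χ of the selected vertices around the cycle,
-- free χ i says that vertex i + 1 (not i) is undominated.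
free : (ℕ → Bool) → ℕ → Bool
free χ i = none (χ i) (χ (1 + i)) (χ (2 + i))

FreePair : (ℕ → Bool) → ℕ → Set
FreePair χ i = T (free χ i) × T (free χ (1 + i))

-- By the index shift in `free`, vertex `i + 1` is dominated and a path of at least two undominated
-- vertices begins at vertex `i + 2`.
Start : (ℕ → Bool) → ℕ → Set
Start χ i = ¬ T (free χ i) × FreePair χ (1 + i)

-- Three consecutive values of `free`, as used by `start`, depend on exactly five entries.
window : (ℕ → Bool) → ℕ → Vec Bool 5
window χ i = χ i ∷ χ (1 + i) ∷ χ (2 + i) ∷ χ (3 + i) ∷ χ (4 + i) ∷ []

-- Summed over all windows, start counts the paths with at least two vertices, so
-- weight gives (k - 1) + 3 = k + 2 for a path on k vertices.
edge start weight : Vec Bool 5 → ℕ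
edge  (a ∷ b ∷ c ∷ d ∷ e ∷ []) = bit (none a b c ∧ none b c d)
start (a ∷ b ∷ c ∷ d ∷ e ∷ []) = bit (not (none a b c) ∧ none b c d ∧ none c d e)
weight w = edge w + 3 * start w

-- Sums over one period

sumFrom : ℕ → (ℕ → ℕ) → ℕ → ℕ
sumFrom zero    f b = 0
sumFrom (suc n) f b = f b + sumFrom n f (suc b)

sumFrom-snoc : ∀ n f b → sumFrom (suc n) f b ≡ sumFrom n f b + f (n + b)
sumFrom-snoc zero    f b = +-identityʳ (f b)
sumFrom-snoc (suc n) f b = begin
  f b + sumFrom (suc n) f (suc b)             ≡⟨ cong (f b +_) (sumFrom-snoc n f (suc b)) ⟩
  f b + (sumFrom n f (suc b) + f (n + suc b)) ≡⟨ +-assoc (f b) _ _ ⟨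
  sumFrom (suc n) f b + f (n + suc b)
    ≡⟨ cong (λ i → sumFrom (suc n) f b + f i) (+-suc n b) ⟩
  sumFrom (suc n) f b + f (suc n + b)         ∎
  where open ≡-Reasoning

-- Shifting the range by one drops `f b` and gains `f (n + b)`, which are equal.
sumFrom-periodic : ∀ n f → (∀ i → f (n + i) ≡ f i) → ∀ b → sumFrom n f b ≡ sumFrom n f 0
sumFrom-periodic n f period zero    = refl
sumFrom-periodic n f period (suc b) =
  trans (+-cancelˡ-≡ (f b) _ _ shift) (sumFrom-periodic n f period b)
  where
  open ≡-Reasoning
  shift : f b + sumFrom n f (suc b) ≡ f b + sumFrom n f b
  shift = begin
    f b + sumFrom n f (suc b)  ≡⟨ sumFrom-snoc n f b ⟩
    sumFrom n f b + f (n + b)  ≡⟨ cong (sumFrom n f b +_) (period b) ⟩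
    sumFrom n f b + f b        ≡⟨ +-comm _ (f b) ⟩
    f b + sumFrom n f b        ∎

sumFrom-+ : ∀ k n f b → sumFrom (k + n) f b ≡ sumFrom k f b + sumFrom n f (k + b)
sumFrom-+ zero    n f b = refl
sumFrom-+ (suc k) n f b = begin
  f b + sumFrom (k + n) f (suc b)                         ≡⟨ cong (f b +_) (sumFrom-+ k n f (suc b)) ⟩
  f b + (sumFrom k f (suc b) + sumFrom n f (k + suc b))   ≡⟨ +-assoc (f b) _ _ ⟨
  sumFrom (suc k) f b + sumFrom n f (k + suc b)
    ≡⟨ cong (λ i → sumFrom (suc k) f b + sumFrom n f i) (+-suc k b) ⟩
  sumFrom (suc k) f b + sumFrom n f (suc k + b)           ∎
  where open ≡-Reasoning

sumFrom-cong : ∀ n {f g} b → (∀ k → k < n → f (k + b) ≡ g (k + b)) →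
               sumFrom n f b ≡ sumFrom n g b
sumFrom-cong zero    b f≡g = refl
sumFrom-cong (suc n) {f} {g} b f≡g =
  cong₂ _+_ (f≡g 0 (s≤s z≤n))
    (sumFrom-cong n (suc b) λ k k<n →
      subst (λ i → f i ≡ g i) (sym (+-suc k b)) (f≡g (suc k) (s≤s k<n)))

sumFrom-1 : ∀ n b → sumFrom n (λ _ → 1) b ≡ n
sumFrom-1 zero    b = refl
sumFrom-1 (suc n) b = cong suc (sumFrom-1 n (suc b))

sumFrom-positive : ∀ n f b → 1 ≤ sumFrom n f b → ∃ λ i → 1 ≤ f i
sumFrom-positive (suc n) f b pos with f b in eq
... | suc _ = b , ≤-trans (s≤s z≤n) (≤-reflexive (sym eq))
... | zero  = sumFrom-positive n f (suc b) pos

-- From undominated edges to path starts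

pair-of-edge : ∀ χ i → 1 ≤ edge (window χ i) → FreePair χ i
pair-of-edge χ i pos with free χ i | free χ (1 + i)
... | true | true = tt , tt

-- Walk back from the pair towards `z`; the first dominated vertex met lies just before the start of
-- a path.
start-between : ∀ χ z d → ¬ T (free χ z) → FreePair χ (d + z) → ∃ (Start χ)
start-between χ z zero    ¬fz (fz , _)  = contradiction fz ¬fz
start-between χ z (suc d) ¬fz pair@(f₁ , _) with T? (free χ (d + z))
... | yes f₀ = start-between χ z d ¬fz (f₀ , f₁)
... | no ¬f₀ = d + z , ¬f₀ , pair

-- Local effect of a move on nine consecutive vertices

nth : ∀ {n} → Vec Bool n → ℕ → Bool
nth []       _       = false
nth (c ∷ cs) zero    = c
nth (c ∷ cs) (suc i) = nth cs i

-- The contribution of the five windows containing the middle of nine vertices: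
-- the only ones affected by selecting that vertex.
local : (Vec Bool 5 → ℕ) → Vec Bool 9 → ℕ
local ω v = sumFrom 5 (ω ∘ window (nth v)) 0

selectMiddle : Vec Bool 9 → Vec Bool 9
selectMiddle (a ∷ b ∷ c ∷ d ∷ _ ∷ v) = a ∷ b ∷ c ∷ d ∷ true ∷ v

-- The three groups belong to the vertices `3 + b`, `4 + b`, `5 + b` that `4 + b` dominates; each
-- lists the two cycle edges at that vertex.
PairNear : (ℕ → Bool) → ℕ → Set
PairNear χ b = (FreePair χ (1 + b) ⊎ FreePair χ (2 + b)) ⊎
               (FreePair χ (2 + b) ⊎ FreePair χ (3 + b)) ⊎
               (FreePair χ (3 + b) ⊎ FreePair χ (4 + b))

allVec? : ∀ n {P : Vec Bool n → Set} → (∀ v → Dec (P v)) → Dec (∀ v → P v)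
allVec? zero    P? = map′ (λ { p [] → p }) (λ p → p []) (P? [])
allVec? (suc n) P? =
  map′ (λ { (p , q) (true ∷ v) → p v ; (p , q) (false ∷ v) → q v })
       (λ p → p ∘ (true ∷_) , p ∘ (false ∷_))
       (allVec? n (P? ∘ (true ∷_)) ×-dec allVec? n (P? ∘ (false ∷_)))

pair? : ∀ χ i → Dec (FreePair χ i)
pair? χ i = T? (free χ i) ×-dec T? (free χ (1 + i))

start? : ∀ χ i → Dec (Start χ i)
start? χ i = ¬? (T? (free χ i)) ×-dec pair? χ (1 + i)

near? : ∀ χ b → Dec (PairNear χ b)
near? χ b = (pair? χ (1 + b) ⊎-dec pair? χ (2 + b)) ⊎-dec
            (pair? χ (2 + b) ⊎-dec pair? χ (3 + b)) ⊎-dec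
            (pair? χ (3 + b) ⊎-dec pair? χ (4 + b))

-- A move newly dominates at most three consecutive vertices, and these meet at most four edges.
-- This and the next three estimates are decided by running through all 512 vectors.
local-edge-drop≤4 : ∀ v → local edge v ≤ 4 + local edge (selectMiddle v)
local-edge-drop≤4 = toWitness
  {a? = allVec? 9 λ v → local edge v ≤? 4 + local edge (selectMiddle v)} tt

-- Even splitting a path on `k` vertices into paths on `a` and `b` vertices, where `a + b = k - 3`,
-- lowers the weight from `k + 2` to `(a + 2) + (b + 2) = k + 1`.
local-weight-drop≥1 : ∀ v → PairNear (nth v) 0 →
                      1 + local weight (selectMiddle v) ≤ local weight v
local-weight-drop≥1 = toWitness
  {a? = allVec? 9 λ v → near? (nth v) 0 →-dec
          (1 + local weight (selectMiddle v) ≤? local weight v)} tt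

-- The path begins with vertices 2 and 3; selecting vertex 4 dominates 3, 4, 5 and isolates 2. A
-- path on `k` vertices keeps `k - 4`, or vanishes together with its weight `k + 2`, which is at
-- least 4.
local-weight-drop≥4 : ∀ v → Start (nth v) 0 →
                      4 + local weight (selectMiddle v) ≤ local weight v
local-weight-drop≥4 = toWitness
  {a? = allVec? 9 λ v → start? (nth v) 0 →-dec
          (4 + local weight (selectMiddle v) ≤? local weight v)} tt

-- Vertex 4 is dominated but vertex 5 is not, so vertex 3 is selected. Selecting 4 therefore newly
-- dominates only 5, the end of a path, which loses one edge.
local-edge-drop≤1 : ∀ v → Start (nth v) 3 →
                    local edge v ≤ 1 + local edge (selectMiddle v)
local-edge-drop≤1 = toWitness
  {a? = allVec? 9 λ v → start? (nth v) 3 →-dec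
          (local edge v ≤? 1 + local edge (selectMiddle v))} tt

-- The abstract subtraction game

-- Lengths of the abstract game in which Staller subtracts 1 from a number and
-- Dominator subtracts 4, until fewer than 4 remain.
mutual

  stallerFirst : ℕ → ℕ
  stallerFirst (suc (suc (suc (suc w)))) = suc (dominatorFirst (suc (suc (suc w))))
  stallerFirst _                         = 0

  dominatorFirst : ℕ → ℕ
  dominatorFirst (suc (suc (suc (suc w)))) = suc (stallerFirst w)
  dominatorFirst _                         = 0

-- Truncated subtraction is harmless here: for `v < 3` both sides are `0`.
stallerFirst-∸3 : ∀ v → stallerFirst v ≤ stallerFirst (3 + (v ∸ 3))
stallerFirst-∸3 0 = ≤-refl
stallerFirst-∸3 1 = ≤-refl
stallerFirst-∸3 2 = ≤-refl
stallerFirst-∸3 (suc (suc (suc v))) = ≤-refl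

-- Boolean extensionality and insertion of a vertex

T-ext : ∀ {a b} → (T a → T b) → (T b → T a) → a ≡ b
T-ext {false} {false} f g = refl
T-ext {false} {true}  f g = ⊥-elim (g tt)
T-ext {true}  {false} f g = ⊥-elim (f tt)
T-ext {true}  {true}  f g = refl

insertV-self : ∀ {n} (X : VSet n) x → insertV X x x ≡ true
insertV-self X x = to T-≡ (from (T-∨ {X x}) (inj₂ (fromWitness {a? = x ≟ x} refl)))

insertV-other : ∀ {n} (X : VSet n) x {v} → v ≢ x → insertV X x v ≡ X v
insertV-other X x {v} v≢x = T-ext
  ([ id , (λ q → contradiction (toWitness {a? = v ≟ x} q) v≢x) ]′ ∘ to (T-∨ {X v}))
  (from (T-∨ {X v}) ∘ inj₁)

ιg-C-moves : ∀ n → ιg-C n ≡ GameProperties.moves (cycleAdj n) n Game.Dominator emptyV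
ιg-C-moves n = GameProperties.ιg-moves (cycleAdj n)

ιg′-C-moves : ∀ n → ιg′-C n ≡ GameProperties.moves (cycleAdj n) n Game.Staller emptyV
ιg′-C-moves n = GameProperties.ιg′-moves (cycleAdj n)

-- Cycles with at least five vertices: indices modulo `N`

module Cycle (m : ℕ) where

  N : ℕ
  N = 5 + m

  open Game (cycleAdj N)
  open GameProperties (cycleAdj N)

  opaque
    ⟦_⟧ : ℕ → Fin N
    ⟦ i ⟧ = i mod N

    toℕ-⟦⟧ : ∀ i → toℕ ⟦ i ⟧ ≡ i % N
    toℕ-⟦⟧ i = toℕ-fromℕ< (m%n<n i N)

  ⟦⟧-cong : ∀ {i j} → i % N ≡ j % N → ⟦ i ⟧ ≡ ⟦ j ⟧
  ⟦⟧-cong {i} {j} eq = toℕ-injective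
    (trans (toℕ-⟦⟧ i) (trans eq (sym (toℕ-⟦⟧ j))))

  ⟦toℕ⟧ : ∀ x → ⟦ toℕ x ⟧ ≡ x
  ⟦toℕ⟧ x = toℕ-injective (trans (toℕ-⟦⟧ (toℕ x)) (m<n⇒m%n≡m (toℕ<n x)))

  %-congˡ : ∀ k {i j} → i % N ≡ j % N → (k + i) % N ≡ (k + j) % N
  %-congˡ k {i} {j} eq = begin
    (k + i) % N          ≡⟨ %-distribˡ-+ k i N ⟩
    (k % N + i % N) % N  ≡⟨ cong (λ r → (k % N + r) % N) eq ⟩
    (k % N + j % N) % N  ≡⟨ %-distribˡ-+ k j N ⟨
    (k + j) % N          ∎
    where open ≡-Reasoning

  %-cancelˡ : ∀ k {i j} → (k + i) % N ≡ (k + j) % N → i % N ≡ j % N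
  %-cancelˡ k {i} {j} eq =
    -- Since `N` is `1 + (4 + m)`, adding `k * (4 + m)` completes `k` to a multiple of `N` and so
    -- acts as subtracting `k`.
    trans (sym (undo i)) (trans (%-congˡ (k * (4 + m)) eq) (undo j))
    where
    open ≡-Reasoning
    undo : ∀ i → (k * (4 + m) + (k + i)) % N ≡ i % N
    undo i = begin
      (k * (4 + m) + (k + i)) % N  ≡⟨ cong (_% N) (+-assoc (k * (4 + m)) k i) ⟨
      (k * (4 + m) + k + i) % N    ≡⟨ cong (λ z → (z + i) % N) (+-comm _ k) ⟩
      (k + k * (4 + m) + i) % N    ≡⟨ cong (λ z → (z + i) % N) (*-suc k (4 + m)) ⟨
      (k * N + i) % N              ≡⟨ cong (_% N) (+-comm (k * N) i) ⟩
      (i + k * N) % N              ≡⟨ [m+kn]%n≡m%n i k N ⟩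
      i % N                        ∎

  ⟦⟧-period : ∀ k i → ⟦ i + k * N ⟧ ≡ ⟦ i ⟧
  ⟦⟧-period k i = ⟦⟧-cong ([m+kn]%n≡m%n i k N)

  ⟦⟧-turn : ∀ j i → ⟦ j + (N + i) ⟧ ≡ ⟦ j + i ⟧
  ⟦⟧-turn j i =
    ⟦⟧-cong (%-congˡ j (trans (cong (_% N) (+-comm N i)) ([m+n]%n≡m%n i N)))

  ⟦⟧-distinct : ∀ t c → t < 4 + m → ⟦ suc t + c ⟧ ≢ ⟦ c ⟧
  ⟦⟧-distinct t c t<4+m eq =
    case trans (sym (m<n⇒m%n≡m (s≤s t<4+m))) (%-cancelˡ c {suc t} {0} eq′) of λ ()
    where
    open ≡-Reasoning
    eq′ : (c + suc t) % N ≡ (c + 0) % N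
    eq′ = begin
      (c + suc t) % N   ≡⟨ cong (_% N) (+-comm c (suc t)) ⟩
      (suc t + c) % N   ≡⟨ toℕ-⟦⟧ (suc t + c) ⟨
      toℕ ⟦ suc t + c ⟧ ≡⟨ cong toℕ eq ⟩
      toℕ ⟦ c ⟧         ≡⟨ toℕ-⟦⟧ c ⟩
      c % N             ≡⟨ cong (_% N) (+-identityʳ c) ⟨
      (c + 0) % N       ∎

  ⟦⟧-suc≢ : ∀ i → ⟦ 1 + i ⟧ ≢ ⟦ i ⟧
  ⟦⟧-suc≢ i = ⟦⟧-distinct 0 i (s≤s z≤n)

  -- Adjacency in the cycle

  Next : Fin N → Fin N → Set
  Next u v = toℕ v ≡ (toℕ u + 1) % N

  adj⁻ : ∀ {u v} → T (cycleAdj N u v) → Next u v ⊎ Next v u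
  adj⁻ {u} {v} p with to (T-∨ {toℕ v ≡ᵇ (toℕ u + 1) % N}) (proj₁ (to T-∧ p))
  ... | inj₁ q = inj₁ (≡ᵇ⇒≡ _ _ q)
  ... | inj₂ q = inj₂ (≡ᵇ⇒≡ _ _ q)

  adj⁺ : ∀ {u v} → Next u v ⊎ Next v u → u ≢ v → T (cycleAdj N u v)
  adj⁺ {u} {v} next u≢v = from T-∧
    ( from (T-∨ {toℕ v ≡ᵇ (toℕ u + 1) % N})
        ([ inj₁ ∘ ≡⇒≡ᵇ _ _ , inj₂ ∘ ≡⇒≡ᵇ _ _ ]′ next)
    , from T-not-≡ (T-ext {⌊ u ≟ v ⌋} (u≢v ∘ toWitness {a? = u ≟ v}) λ ()) )

  next-⟦⟧ : ∀ i → Next ⟦ i ⟧ ⟦ 1 + i ⟧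
  next-⟦⟧ i = begin
    toℕ ⟦ 1 + i ⟧          ≡⟨ toℕ-⟦⟧ (1 + i) ⟩
    (1 + i) % N            ≡⟨ %-congˡ 1 {i % N} {i} (m%n%n≡m%n i N) ⟨
    (1 + i % N) % N        ≡⟨ cong (_% N) (+-comm 1 (i % N)) ⟩
    (i % N + 1) % N        ≡⟨ cong (λ r → (r + 1) % N) (toℕ-⟦⟧ i) ⟨
    (toℕ ⟦ i ⟧ + 1) % N    ∎
    where open ≡-Reasoning

  next-unique : ∀ {u v w} → Next u v → Next u w → v ≡ w
  next-unique p q = toℕ-injective (trans p (sym q))

  next-injective : ∀ {u v w} → Next u w → Next v w → u ≡ v
  next-injective {u} {v} p q = begin
    u          ≡⟨ ⟦toℕ⟧ u ⟨
    ⟦ toℕ u ⟧  ≡⟨ ⟦⟧-cong {toℕ u} {toℕ v} (%-cancelˡ 1 {toℕ u} {toℕ v} eq) ⟩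
    ⟦ toℕ v ⟧  ≡⟨ ⟦toℕ⟧ v ⟩
    v          ∎
    where
    open ≡-Reasoning
    eq : (1 + toℕ u) % N ≡ (1 + toℕ v) % N
    eq = begin
      (1 + toℕ u) % N ≡⟨ cong (_% N) (+-comm 1 (toℕ u)) ⟩
      (toℕ u + 1) % N ≡⟨ trans (sym p) q ⟩
      (toℕ v + 1) % N ≡⟨ cong (_% N) (+-comm (toℕ v) 1) ⟩
      (1 + toℕ v) % N ∎

  adj-suc : ∀ i → T (cycleAdj N ⟦ i ⟧ ⟦ 1 + i ⟧)
  adj-suc i = adj⁺ (inj₁ (next-⟦⟧ i)) (⟦⟧-suc≢ i ∘ sym)

  adj-pred : ∀ i → T (cycleAdj N ⟦ 1 + i ⟧ ⟦ i ⟧)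
  adj-pred i = adj⁺ (inj₂ (next-⟦⟧ i)) (⟦⟧-suc≢ i)

  neighbours : ∀ i {v} → Next ⟦ 1 + i ⟧ v ⊎ Next v ⟦ 1 + i ⟧ → v ≡ ⟦ i ⟧ ⊎ v ≡ ⟦ 2 + i ⟧
  neighbours i (inj₁ p) = inj₂ (next-unique {⟦ 1 + i ⟧} p (next-⟦⟧ (1 + i)))
  neighbours i (inj₂ p) = inj₁ (next-injective p (next-⟦⟧ i))

  adjʳ-cases : ∀ i {v} → T (cycleAdj N ⟦ 1 + i ⟧ v) → v ≡ ⟦ i ⟧ ⊎ v ≡ ⟦ 2 + i ⟧
  adjʳ-cases i p = neighbours i (adj⁻ p)

  adjˡ-cases : ∀ i {v} → T (cycleAdj N v ⟦ 1 + i ⟧) → v ≡ ⟦ i ⟧ ⊎ v ≡ ⟦ 2 + i ⟧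
  adjˡ-cases i p = neighbours i (swap (adj⁻ p))

  -- Domination and playability in terms of the indicator sequence

  χ : VSet N → ℕ → Bool
  χ X i = X ⟦ i ⟧

  residual-⟦⟧ : ∀ X i → residual X ⟦ 1 + i ⟧ ≡ free (χ X) i
  residual-⟦⟧ X i = cong not (T-ext ⇒ ⇐)
    where
    chosen : Fin N → Bool
    chosen u = X u ∧ cycleAdj N u ⟦ 1 + i ⟧

    ⇒ : T (closedNbhd X ⟦ 1 + i ⟧) → T (χ X i ∨ χ X (1 + i) ∨ χ X (2 + i))
    ⇒ p with to (T-∨ {χ X (1 + i)}) p
    ... | inj₁ x₁ = from (T-∨ {χ X i}) (inj₂ (from T-∨ (inj₁ x₁)))
    ... | inj₂ q with u , q′ ← anyV⁻ chosen q
                 with xu , ui ← to (T-∧ {X u}) q′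
                 with adjˡ-cases i ui
    ...   | inj₁ refl = from T-∨ (inj₁ xu)
    ...   | inj₂ refl = from (T-∨ {χ X i}) (inj₂ (from (T-∨ {χ X (1 + i)}) (inj₂ xu)))

    ⇐ : T (χ X i ∨ χ X (1 + i) ∨ χ X (2 + i)) → T (closedNbhd X ⟦ 1 + i ⟧)
    ⇐ p with to (T-∨ {χ X i}) p
    ... | inj₁ x₀ = from (T-∨ {χ X (1 + i)})
                      (inj₂ (anyV⁺ chosen ⟦ i ⟧ (from T-∧ (x₀ , adj-suc i))))
    ... | inj₂ q with to (T-∨ {χ X (1 + i)}) q
    ...   | inj₁ x₁ = from T-∨ (inj₁ x₁)
    ...   | inj₂ x₂ = from (T-∨ {χ X (1 + i)})
                        (inj₂ (anyV⁺ chosen ⟦ 2 + i ⟧ (from T-∧ (x₂ , adj-pred (1 + i)))))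

  residual-edge⁻ : ∀ X i {u} → ResidualEdge X ⟦ 2 + i ⟧ u →
                   FreePair (χ X) i ⊎ FreePair (χ X) (1 + i)
  residual-edge⁻ X i (residualEdge ry ru yu) with adjʳ-cases (1 + i) yu
  ... | inj₁ refl = inj₁ (subst T (residual-⟦⟧ X i) ru , subst T (residual-⟦⟧ X (1 + i)) ry)
  ... | inj₂ refl = inj₂ (subst T (residual-⟦⟧ X (1 + i)) ry , subst T (residual-⟦⟧ X (2 + i)) ru)

  playable⇒pair : ∀ X b → Playable X ⟦ 4 + b ⟧ → PairNear (χ X) b
  playable⇒pair X b p = go (playable⁻ X p)
    where
    go′ : ∀ {y u} → ResidualEdge X y u → y ≡ ⟦ 3 + b ⟧ ⊎ y ≡ ⟦ 5 + b ⟧ → PairNear (χ X) b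
    go′ e (inj₁ refl) = inj₁ (residual-edge⁻ X (1 + b) e)
    go′ e (inj₂ refl) = inj₂ (inj₂ (residual-edge⁻ X (3 + b) e))

    go : (∃₂ λ y u → ResidualEdge X y u × (⟦ 4 + b ⟧ ≡ y ⊎ T (cycleAdj N ⟦ 4 + b ⟧ y))) →
         PairNear (χ X) b
    go (_ , _ , e , inj₁ refl) = inj₂ (inj₁ (residual-edge⁻ X (2 + b) e))
    go (_ , _ , e , inj₂ xy)   = go′ e (adjʳ-cases (3 + b) xy)

  pair⇒playableˡ : ∀ X i → FreePair (χ X) i → Playable X ⟦ i ⟧
  pair⇒playableˡ X i (f₀ , f₁) = playable⁺ X {⟦ i ⟧} {⟦ 1 + i ⟧} {⟦ 2 + i ⟧}
    (residualEdge (subst T (sym (residual-⟦⟧ X i)) f₀)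
                  (subst T (sym (residual-⟦⟧ X (1 + i))) f₁) (adj-suc (1 + i)))
    (⟦⟧-suc≢ (1 + i) ∘ sym) (adj-suc i)

  pair⇒playableʳ : ∀ X i → FreePair (χ X) i → Playable X ⟦ 3 + i ⟧
  pair⇒playableʳ X i (f₀ , f₁) = playable⁺ X {⟦ 3 + i ⟧} {⟦ 2 + i ⟧} {⟦ 1 + i ⟧}
    (residualEdge (subst T (sym (residual-⟦⟧ X (1 + i))) f₁)
                  (subst T (sym (residual-⟦⟧ X i)) f₀) (adj-pred (1 + i)))
    (⟦⟧-suc≢ (1 + i)) (adj-pred (2 + i))

  -- Change of the potentials under a move

  segment : VSet N → ℕ → Vec Bool 9
  segment X b = χ X b ∷ χ X (1 + b) ∷ χ X (2 + b) ∷ χ X (3 + b) ∷ χ X (4 + b) ∷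
                χ X (5 + b) ∷ χ X (6 + b) ∷ χ X (7 + b) ∷ χ X (8 + b) ∷ []

  module _ (X : VSet N) (b : ℕ) where

    private
      X′ : VSet N
      X′ = insertV X ⟦ 4 + b ⟧

    χ-after : ∀ t → t < 4 + m → χ X′ (t + (5 + b)) ≡ χ X (t + (5 + b))
    χ-after t t< = insertV-other X _
      (subst (λ i → ⟦ i ⟧ ≢ ⟦ 4 + b ⟧) (sym (+-suc t (4 + b))) (⟦⟧-distinct t (4 + b) t<))

    χ-before : ∀ t c → suc t + c ≡ 4 + b → t < 4 + m → χ X′ c ≡ χ X c
    χ-before t c eq t< = insertV-other X ⟦ 4 + b ⟧
      (subst (λ i → ⟦ c ⟧ ≢ ⟦ i ⟧) eq (⟦⟧-distinct t c t< ∘ sym))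

    -- When `N < 9` the segment overlaps itself, but the selected vertex still occurs only in the
    -- middle: the other entries are at offset at most 4 from it, and `N` is at least 5.
    segment-after : segment X′ b ≡ selectMiddle (segment X b)
    segment-after =
      cong₂ _∷_ (χ-before 3 b refl (m≤m+n 4 m))
      (cong₂ _∷_ (χ-before 2 (1 + b) refl (m≤n⇒m≤o+n 1 (m≤m+n 3 m)))
      (cong₂ _∷_ (χ-before 1 (2 + b) refl (m≤n⇒m≤o+n 2 (m≤m+n 2 m)))
      (cong₂ _∷_ (χ-before 0 (3 + b) refl (m≤n⇒m≤o+n 3 (m≤m+n 1 m)))
      (cong₂ _∷_ (insertV-self X ⟦ 4 + b ⟧)
      (cong₂ _∷_ (χ-after 0 (m≤n⇒m≤o+n 3 (m≤m+n 1 m)))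
      (cong₂ _∷_ (χ-after 1 (m≤n⇒m≤o+n 2 (m≤m+n 2 m)))
      (cong₂ _∷_ (χ-after 2 (m≤n⇒m≤o+n 1 (m≤m+n 3 m)))
      (cong₂ _∷_ (χ-after 3 (m≤m+n 4 m)) refl))))))))

    window-after : ∀ k → k < m → window (χ X′) (k + (5 + b)) ≡ window (χ X) (k + (5 + b))
    window-after k k<m =
      cong₂ _∷_ (χ-after k (m≤n⇒m≤o+n 4 k<m))
      (cong₂ _∷_ (χ-after (1 + k) (m≤n⇒m≤o+n 3 (s≤s k<m)))
      (cong₂ _∷_ (χ-after (2 + k) (m≤n⇒m≤o+n 2 (s≤s (s≤s k<m))))
      (cong₂ _∷_ (χ-after (3 + k) (m≤n⇒m≤o+n 1 (s≤s (s≤s (s≤s k<m)))))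
      (cong₂ _∷_ (χ-after (4 + k) (s≤s (s≤s (s≤s (s≤s k<m))))) refl))))

  total : (Vec Bool 5 → ℕ) → VSet N → ℕ
  total ω X = sumFrom N (ω ∘ window (χ X)) 0

  window-turn : ∀ X i → window (χ X) (N + i) ≡ window (χ X) i
  window-turn X i
    rewrite ⟦⟧-turn 0 i | ⟦⟧-turn 1 i | ⟦⟧-turn 2 i | ⟦⟧-turn 3 i | ⟦⟧-turn 4 i = refl

  rest : (Vec Bool 5 → ℕ) → VSet N → ℕ → ℕ
  rest ω X b = sumFrom m (ω ∘ window (χ X)) (5 + b)

  -- By periodicity the sum may begin at `b`, and its first five windows form the local part.
  total-split : ∀ ω X b → total ω X ≡ local ω (segment X b) + rest ω X b
  total-split ω X b =
    trans (sym (sumFrom-periodic N f (λ i → cong ω (window-turn X i)) b)) (sumFrom-+ 5 m f b)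
    where
    f : ℕ → ℕ
    f = ω ∘ window (χ X)

  total-split-after : ∀ ω X b → total ω (insertV X ⟦ 4 + b ⟧) ≡
                      local ω (selectMiddle (segment X b)) + rest ω X b
  total-split-after ω X b = trans (total-split ω (insertV X ⟦ 4 + b ⟧) b)
    (cong₂ _+_ (cong (local ω) (segment-after X b))
      (sumFrom-cong m (5 + b) λ k k<m → cong ω (window-after X b k k<m)))

  total-drop≥ : ∀ ω X b c →
    c + local ω (selectMiddle (segment X b)) ≤ local ω (segment X b) →
    c + total ω (insertV X ⟦ 4 + b ⟧) ≤ total ω X
  total-drop≥ ω X b c local≤ = begin
    c + total ω (insertV X ⟦ 4 + b ⟧)
      ≡⟨ cong (c +_) (total-split-after ω X b) ⟩
    c + (local ω (selectMiddle (segment X b)) + rest ω X b)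
      ≡⟨ +-assoc c _ _ ⟨
    c + local ω (selectMiddle (segment X b)) + rest ω X b
      ≤⟨ +-monoˡ-≤ (rest ω X b) local≤ ⟩
    local ω (segment X b) + rest ω X b
      ≡⟨ total-split ω X b ⟨
    total ω X ∎
    where open ≤-Reasoning

  total-drop≤ : ∀ ω X b c →
    local ω (segment X b) ≤ c + local ω (selectMiddle (segment X b)) →
    total ω X ≤ c + total ω (insertV X ⟦ 4 + b ⟧)
  total-drop≤ ω X b c local≤ = begin
    total ω X
      ≡⟨ total-split ω X b ⟩
    local ω (segment X b) + rest ω X b
      ≤⟨ +-monoˡ-≤ (rest ω X b) local≤ ⟩
    c + local ω (selectMiddle (segment X b)) + rest ω X b
      ≡⟨ +-assoc c _ _ ⟩
    c + (local ω (selectMiddle (segment X b)) + rest ω X b)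
      ≡⟨ cong (c +_) (total-split-after ω X b) ⟨
    c + total ω (insertV X ⟦ 4 + b ⟧) ∎
    where open ≤-Reasoning

  -- Moves available to the players

  centred : ∀ x → ∃ λ b → x ≡ ⟦ 4 + b ⟧
  -- As `4 + suc m` is `N`, this is `toℕ x - 4` after one full turn.
  centred x = toℕ x + suc m , (begin
    x                           ≡⟨ ⟦toℕ⟧ x ⟨
    ⟦ toℕ x ⟧                   ≡⟨ ⟦⟧-turn 0 (toℕ x) ⟨
    ⟦ 5 + (m + toℕ x) ⟧         ≡⟨ cong (λ i → ⟦ 5 + i ⟧) (+-comm m (toℕ x)) ⟩
    ⟦ 5 + (toℕ x + m) ⟧         ≡⟨ cong (λ i → ⟦ 4 + i ⟧) (+-suc (toℕ x) m) ⟨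
    ⟦ 4 + (toℕ x + suc m) ⟧     ∎)
    where open ≡-Reasoning

  -- This excludes the untouched cycle, which has free pairs but no `Start`.
  Started : VSet N → Set
  Started X = ∃ λ z → ¬ T (free (χ X) z)

  started-after : ∀ X x → Started (insertV X x)
  started-after X x =
    toℕ x , λ f → subst (λ b → T (none b (χ X′ (1 + toℕ x)) (χ X′ (2 + toℕ x)))) selected f
    where
    X′ : VSet N
    X′ = insertV X x

    selected : χ X′ (toℕ x) ≡ true
    selected = trans (cong X′ (⟦toℕ⟧ x)) (insertV-self X x)

  edge-drop≤4 : ∀ X x → total edge X ≤ 4 + total edge (insertV X x)
  edge-drop≤4 X x with b , refl ← centred x =
    total-drop≤ edge X b 4 (local-edge-drop≤4 (segment X b))

  weight-drop≥1 : ∀ X x → Playable X x → 1 + total weight (insertV X x) ≤ total weight X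
  weight-drop≥1 X x p with b , refl ← centred x =
    total-drop≥ weight X b 1 (local-weight-drop≥1 (segment X b) (playable⇒pair X b p))

  pair⇒start : ∀ X → Started X → ∃ (FreePair (χ X)) → ∃ (Start (χ X))
  pair⇒start X (z , ¬fz) (i , f₀ , f₁) =
    -- Moving the pair ahead by `z` full turns puts it at or beyond `z`; `i + z * (4 + m)` is then
    -- its distance from `z`.
    start-between (χ X) z (i + z * (4 + m)) ¬fz
      (subst (FreePair (χ X)) later
        (subst T (sym (free-period i)) f₀ , subst T (sym (free-period (1 + i))) f₁))
    where
    free-period : ∀ i → free (χ X) (i + z * N) ≡ free (χ X) i
    free-period i rewrite ⟦⟧-period z i | ⟦⟧-period z (1 + i) | ⟦⟧-period z (2 + i) = refl

    later : i + z * N ≡ i + z * (4 + m) + z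
    later = begin
      i + z * N                ≡⟨ cong (i +_) (*-suc z (4 + m)) ⟩
      i + (z + z * (4 + m))    ≡⟨ cong (i +_) (+-comm z _) ⟩
      i + (z * (4 + m) + z)    ≡⟨ +-assoc i _ z ⟨
      i + z * (4 + m) + z      ∎
      where open ≡-Reasoning

  playable⇒start : ∀ X x → Started X → Playable X x → ∃ (Start (χ X))
  playable⇒start X x started p with b , refl ← centred x =
    pair⇒start X started (pair (playable⇒pair X b p))
    where
    pair : PairNear (χ X) b → ∃ (FreePair (χ X))
    pair = [ [ _ ,_ , _ ,_ ]′ , [ [ _ ,_ , _ ,_ ]′ , [ _ ,_ , _ ,_ ]′ ]′ ]′

  edge⇒start : ∀ X → Started X → 1 ≤ total edge X → ∃ (Start (χ X))
  edge⇒start X started pos with i , e ← sumFrom-positive N (edge ∘ window (χ X)) 0 pos =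
    pair⇒start X started (i , pair-of-edge (χ X) i e)

  Dominator-move : ∀ X → ∃ (Start (χ X)) →
    ∃ λ x → Playable X x × 4 + total weight (insertV X x) ≤ total weight X
  Dominator-move X (b , s@(_ , pair)) =
    ⟦ 4 + b ⟧ , pair⇒playableʳ X (1 + b) pair
    , total-drop≥ weight X b 4 (local-weight-drop≥4 (segment X b) s)

  Staller-move : ∀ X → ∃ (Start (χ X)) →
    ∃ λ x → Playable X x × total edge X ≤ 1 + total edge (insertV X x)
  Staller-move X (b , s) =
    ⟦ 4 + c ⟧ , pair⇒playableˡ X (4 + c) (proj₂ s′)
    , total-drop≤ edge X c 1 (local-edge-drop≤1 (segment X c) s′)
    where
    -- The start at `b` is read one full turn later, at `N + b = 3 + c`, so that the dominated
    -- vertex before the path is the centre `4 + c`.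
    c : ℕ
    c = b + (2 + m)

    N+b≡3+c : N + b ≡ 3 + c
    N+b≡3+c = cong (3 +_) (+-comm (2 + m) b)

    start-turn : Start (χ X) (N + b) ≡ Start (χ X) b
    start-turn rewrite ⟦⟧-turn 0 b | ⟦⟧-turn 1 b | ⟦⟧-turn 2 b | ⟦⟧-turn 3 b | ⟦⟧-turn 4 b = refl

    s′ : Start (χ X) (3 + c)
    s′ = subst (Start (χ X)) N+b≡3+c (subst id (sym start-turn) s)

  -- Lower bounds from the undominated edges

  -- The offset 3 makes the two bounds meet: a path on k vertices has k - 1 edges
  -- and weight k + 2.
  mutual

    Staller-lower : ∀ k X v → Started X → v ≤ total edge X → v ≤ k →
                    stallerFirst (3 + v) ≤ moves k Staller X
    -- Here `stallerFirst 3` is `0`. Otherwise `v ≤ k` supplies fuel for the move, and it persists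
    -- because each move lowers the edge estimate by at least one.
    Staller-lower k       X zero    st v≤E v≤k = z≤n
    Staller-lower (suc k) X (suc v) st v≤E (s≤s v≤k) =
      case Staller-move X (edge⇒start X st (≤-trans (s≤s z≤n) v≤E)) of λ
      { (x , p , drop) → ≤-trans
          (s≤s (Dominator-lower k (insertV X x) v (started-after X x)
                 (s≤s⁻¹ (≤-trans v≤E drop)) v≤k))
          (moves-Staller-≥ k p) }

    Dominator-lower : ∀ k X v → Started X → v ≤ total edge X → v ≤ k →
                      dominatorFirst (3 + v) ≤ moves k Dominator X
    Dominator-lower k       X zero    st v≤E v≤k = z≤n
    Dominator-lower (suc k) X (suc v) st v≤E (s≤s v≤k) =
      moves-Dominator-≥ k
        (proj₁ (proj₂ (Dominator-move X (edge⇒start X st (≤-trans (s≤s z≤n) v≤E)))))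
        λ x _ → ≤-trans (stallerFirst-∸3 v)
          (Staller-lower k (insertV X x) (v ∸ 3) (started-after X x)
            (≤-trans (∸-monoˡ-≤ 4 v≤E) (m≤n+o⇒m∸n≤o _ 4 (edge-drop≤4 X x)))
            (≤-trans (m∸n≤m v 3) v≤k))

  -- Upper bounds from the weight

  stuck⊎weighty : ∀ X w → Started X → total weight X ≤ w →
                  (∀ k p → moves k p X ≡ 0) ⊎ (∃ (Start (χ X)) × ∃ λ u → w ≡ 4 + u)
  stuck⊎weighty X w st W≤w = Sum.map id
    -- Dominator's drop by 4 shows that the weight, and with it `w`, is at least 4.
    (λ (x , p) → let s = playable⇒start X x st p ; (_ , _ , drop) = Dominator-move X s in
                 s , w ∸ 4 , sym (m+[n∸m]≡n (≤-trans (m≤m+n 4 _) (≤-trans drop W≤w))))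
    (stuck⊎playable X)

  mutual

    -- While the game goes on, `w` has the form `4 + u`, so the abstract game also continues.
    -- Allowing every `w` above the weight absorbs drops larger than 1 or 4 without a monotonicity
    -- argument.
    Staller-upper : ∀ k X w → Started X → total weight X ≤ w →
                    moves k Staller X ≤ stallerFirst w
    Staller-upper k X w st W≤w =
      [ (λ stuck → ≤-trans (≤-reflexive (stuck k Staller)) z≤n)
      , (λ { (_ , u , refl) → Staller-upper-playable k X u W≤w }) ]′
      (stuck⊎weighty X w st W≤w)

    Staller-upper-playable : ∀ k X u → total weight X ≤ 4 + u →
                             moves k Staller X ≤ stallerFirst (4 + u)
    Staller-upper-playable zero    X u W≤w = ≤-trans (≤-reflexive (moves-zero Staller X)) z≤n
    Staller-upper-playable (suc k) X u W≤w = moves-Staller-≤ k λ x p →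
      Dominator-upper k (insertV X x) (3 + u) (started-after X x)
        (s≤s⁻¹ (≤-trans (weight-drop≥1 X x p) W≤w))

    Dominator-upper : ∀ k X w → Started X → total weight X ≤ w →
                      moves k Dominator X ≤ dominatorFirst w
    Dominator-upper k X w st W≤w =
      [ (λ stuck → ≤-trans (≤-reflexive (stuck k Dominator)) z≤n)
      , (λ { (s , u , refl) → Dominator-upper-playable k X u s W≤w }) ]′
      (stuck⊎weighty X w st W≤w)

    Dominator-upper-playable : ∀ k X u → ∃ (Start (χ X)) → total weight X ≤ 4 + u →
                               moves k Dominator X ≤ dominatorFirst (4 + u)
    Dominator-upper-playable zero    X u s W≤w =
      ≤-trans (≤-reflexive (moves-zero Dominator X)) z≤n
    Dominator-upper-playable (suc k) X u s W≤w =
      let (x , p , drop) = Dominator-move X s in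
      ≤-trans (moves-Dominator-≤ k p)
        (s≤s (Staller-upper k (insertV X x) u (started-after X x)
               (+-cancelˡ-≤ 4 _ _ (≤-trans drop W≤w))))

  -- The first move, from the untouched cycle

  total-empty : ∀ ω → ω (window (χ emptyV) 0) ≡ 1 → total ω emptyV ≡ N
  total-empty ω one =
    trans (sumFrom-cong N {ω ∘ window (χ emptyV)} {λ _ → 1} 0 λ _ _ → one) (sumFrom-1 N 0)

  playable-empty : Playable emptyV ⟦ 0 ⟧
  playable-empty = pair⇒playableˡ emptyV 0 (tt , tt)

  edge-after-first : ∀ x → 1 + m ≤ total edge (insertV emptyV x)
  edge-after-first x = +-cancelˡ-≤ 4 _ _
    (≤-trans (≤-reflexive (sym (total-empty edge refl))) (edge-drop≤4 emptyV x))

  weight-after-first : ∀ x → Playable emptyV x → total weight (insertV emptyV x) ≤ 4 + m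
  weight-after-first x p =
    s≤s⁻¹ (≤-trans (weight-drop≥1 emptyV x p) (≤-reflexive (total-empty weight refl)))

  -- After the first move at least `1 + m` edges remain and the weight is at most `4 + m`; with the
  -- offset 3 both bounds are `stallerFirst (4 + m)`.
  ιg-value : ιg-C N ≡ 1 + stallerFirst (4 + m)
  ιg-value = trans (ιg-C-moves N) (≤-antisym
    (≤-trans (moves-Dominator-≤ (4 + m) playable-empty)
      (s≤s (Staller-upper (4 + m) _ (4 + m) (started-after emptyV ⟦ 0 ⟧)
             (weight-after-first ⟦ 0 ⟧ playable-empty))))
    (moves-Dominator-≥ (4 + m) playable-empty λ x _ →
      Staller-lower (4 + m) _ (1 + m) (started-after emptyV x) (edge-after-first x)
        (m≤n+m (1 + m) 3)))

  ιg′-value : ιg′-C N ≡ stallerFirst N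
  ιg′-value = trans (ιg′-C-moves N) (≤-antisym
    -- The untouched cycle is not `Started`, so the upper bound is entered at its playable case,
    -- with weight `N`.
    (Staller-upper-playable N emptyV (1 + m) (≤-reflexive (total-empty weight refl)))
    (≤-trans
      (s≤s (Dominator-lower (4 + m) _ (1 + m) (started-after emptyV ⟦ 0 ⟧)
             (edge-after-first ⟦ 0 ⟧) (m≤n+m (1 + m) 3)))
      (moves-Staller-≥ (4 + m) playable-empty)))

-- Closed form of the abstract game

stallerFirst-turns : ∀ q r → stallerFirst (q * 5 + r) ≡ 2 * q + stallerFirst r
stallerFirst-turns zero    r = refl
stallerFirst-turns (suc q) r = begin
  -- One move by each player has already been unfolded, lowering the argument by 5.
  2 + stallerFirst (q * 5 + r)     ≡⟨ cong (2 +_) (stallerFirst-turns q r) ⟩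
  2 + (2 * q + stallerFirst r)     ≡⟨ +-assoc 2 (2 * q) _ ⟨
  2 + 2 * q + stallerFirst r       ≡⟨ cong (_+ stallerFirst r) (*-suc 2 q) ⟨
  2 * suc q + stallerFirst r       ∎
  where open ≡-Reasoning

stallerFirst-closed : ∀ n → stallerFirst n ≡ 2 * (n / 5) + stallerFirst (n % 5)
stallerFirst-closed n = trans
  (cong stallerFirst (trans (m≡m%n+[m/n]*n n 5) (+-comm (n % 5) _)))
  (stallerFirst-turns (n / 5) (n % 5))

stallerFirst-<4 : ∀ {r} → r < 4 → stallerFirst r ≡ 0
stallerFirst-<4 {0} _ = refl
stallerFirst-<4 {1} _ = refl
stallerFirst-<4 {2} _ = refl
stallerFirst-<4 {3} _ = refl
stallerFirst-<4 {suc (suc (suc (suc _)))} (s≤s (s≤s (s≤s (s≤s ()))))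

stallerFirst-%5≡4 : ∀ n → n % 5 ≡ 4 → stallerFirst n ≡ 2 * (n / 5) + 1
stallerFirst-%5≡4 n eq =
  trans (stallerFirst-closed n) (cong (λ r → 2 * (n / 5) + stallerFirst r) eq)

stallerFirst-%5≢4 : ∀ n → n % 5 ≢ 4 → stallerFirst n ≡ 2 * (n / 5)
stallerFirst-%5≢4 n neq = begin
  stallerFirst n                        ≡⟨ stallerFirst-closed n ⟩
  2 * (n / 5) + stallerFirst (n % 5)    ≡⟨ cong (2 * (n / 5) +_) (stallerFirst-<4 r<4) ⟩
  2 * (n / 5) + 0                       ≡⟨ +-identityʳ _ ⟩
  2 * (n / 5)                           ∎
  where
  open ≡-Reasoning
  r<4 : n % 5 < 4
  r<4 = ≤∧≢⇒< (s≤s⁻¹ (m%n<n n 5)) neq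

-- Rounding up, and the passage from `k` to `n = 1 + k`

%5≡4⇒suc%5≡0 : ∀ k → k % 5 ≡ 4 → suc k % 5 ≡ 0
%5≡4⇒suc%5≡0 k eq = trans (%-distribˡ-+ 1 k 5) (cong (λ r → (1 + r) % 5) eq)

⌈suc/5⌉ : ∀ k → ⌈ suc k /5⌉ ≡ suc (k / 5)
⌈suc/5⌉ k = trans (cong (_/ 5) (+-comm (suc k) 4)) (+-distrib-/-∣ˡ {5} k {5} (divides 1 refl))

module _ (k : ℕ) {n ι : ℕ} (n≡1+k : n ≡ suc k) (ι-value : ι ≡ 1 + stallerFirst k) where

  open ≡-Reasoning

  -- Here `k` has remainder 4, so Staller makes one extra move after the full rounds; together with
  -- Dominator's opening move this completes a further pair.
  ⌈/5⌉-divisible : n % 5 ≡ 0 → ι ≡ 2 * ⌈ n /5⌉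
  ⌈/5⌉-divisible eq = begin
    ι                       ≡⟨ ι-value ⟩
    1 + stallerFirst k      ≡⟨ cong suc (stallerFirst-%5≡4 k k%5≡4) ⟩
    1 + (2 * (k / 5) + 1)   ≡⟨ cong suc (+-comm _ 1) ⟩
    2 + 2 * (k / 5)         ≡⟨ *-suc 2 (k / 5) ⟨
    2 * suc (k / 5)         ≡⟨ cong (2 *_) (⌈suc/5⌉ k) ⟨
    2 * ⌈ suc k /5⌉         ≡⟨ cong (λ i → 2 * ⌈ i /5⌉) n≡1+k ⟨
    2 * ⌈ n /5⌉             ∎
    where
    k%5≡4 : k % 5 ≡ 4
    k%5≡4 = %-pred-≡0 {k} (trans (cong (_% 5) (sym n≡1+k)) eq)

  ⌈/5⌉-indivisible : n % 5 ≢ 0 → ι ≡ 2 * ⌈ n /5⌉ ∸ 1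
  ⌈/5⌉-indivisible neq = begin
    ι                       ≡⟨ ι-value ⟩
    1 + stallerFirst k      ≡⟨ cong suc (stallerFirst-%5≢4 k k%5≢4) ⟩
    1 + 2 * (k / 5)         ≡⟨ cong (_∸ 1) (*-suc 2 (k / 5)) ⟨
    2 * suc (k / 5) ∸ 1     ≡⟨ cong (λ c → 2 * c ∸ 1) (⌈suc/5⌉ k) ⟨
    2 * ⌈ suc k /5⌉ ∸ 1     ≡⟨ cong (λ i → 2 * ⌈ i /5⌉ ∸ 1) n≡1+k ⟨
    2 * ⌈ n /5⌉ ∸ 1         ∎
    where
    k%5≢4 : k % 5 ≢ 4
    k%5≢4 eq = neq (trans (cong (_% 5) n≡1+k) (%5≡4⇒suc%5≡0 k eq))

-- The equations for n are transported, not matched on: ιg-C n must not unfold.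
module _ {n : ℕ} where

  ιg-C-value : n ≡ 4 ⊎ 5 ≤ n → ιg-C n ≡ 1 + stallerFirst (n ∸ 1)
  ιg-C-value (inj₁ n≡4) =
    -- The cycle on four vertices is too short for `Cycle`; `refl` evaluates its whole game tree.
    subst (λ i → ιg-C i ≡ 1 + stallerFirst (i ∸ 1)) (sym n≡4) refl
  ιg-C-value (inj₂ 5≤n) =
    subst (λ i → ιg-C i ≡ 1 + stallerFirst (i ∸ 1)) (m+[n∸m]≡n 5≤n) (Cycle.ιg-value (n ∸ 5))

  ιg′-C-value : n ≡ 4 ⊎ 5 ≤ n → ιg′-C n ≡ stallerFirst n
  ιg′-C-value (inj₁ n≡4) = subst (λ i → ιg′-C i ≡ stallerFirst i) (sym n≡4) refl
  ιg′-C-value (inj₂ 5≤n) =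
    subst (λ i → ιg′-C i ≡ stallerFirst i) (m+[n∸m]≡n 5≤n) (Cycle.ιg′-value (n ∸ 5))

theorem2p3 : (n : ℕ) → 4 ≤ n →
    ((n % 5 ≡ 0 → ιg-C n ≡ 2 * ⌈ n /5⌉)
    × (¬ (n % 5 ≡ 0) → ιg-C n ≡ 2 * ⌈ n /5⌉ ∸ 1))
    × ((n % 5 ≡ 4 → ιg′-C n ≡ 2 * ⌊ n /5⌋ + 1)
    × (¬ (n % 5 ≡ 4) → ιg′-C n ≡ 2 * ⌊ n /5⌋))
theorem2p3 n 4≤n =
  ( ⌈/5⌉-divisible (n ∸ 1) n≡1+[n∸1] (ιg-C-value size)
  , ⌈/5⌉-indivisible (n ∸ 1) n≡1+[n∸1] (ιg-C-value size) )
  , (λ eq → trans (ιg′-C-value size) (stallerFirst-%5≡4 n eq))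
  , (λ neq → trans (ιg′-C-value size) (stallerFirst-%5≢4 n neq))
  where
  size : n ≡ 4 ⊎ 5 ≤ n
  size = Sum.map sym id (swap (m≤n⇒m<n∨m≡n 4≤n))

  n≡1+[n∸1] : n ≡ suc (n ∸ 1)
  n≡1+[n∸1] = sym (m+[n∸m]≡n (≤-trans (s≤s z≤n) 4≤n))
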